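{- For every integer $i$: $\tilde{\tilde H}_{k,0}(a;x;q)=0$ and $\tilde{\tilde H}_{k,-i}(a;x;q)=-x^{ -i}\tilde{\tilde H}_{k,i}(a;x;q)$.
   Context: Fix an integer $k\ge2$. Notation: $(a;q)_n=\prod_{m=0}^{n-1}(1-aq^m)$, $(a;q)_\infty=\prod_{m\ge0}(1-aq^m)$. For integers $i$: $\tilde H_{k,i}(a;x;q)=\sum_{n\ge0}\dfrac{(-a)^nq^{kn^2-\binom n2+n-in}x^{(k-1)n}(1-x^iq^{2ni})(-x;q)_n(-1/a;q)_n(-axq^{n+1};q)_\infty}{(q^2;q^2)_n(xq^n;q)_\infty}$ and $\tilde{\tilde H}_{k,i}(a;x;q)=\dfrac{\tilde H_{k,i+1}(a;x;q)+x\,\tilde H_{k,i-1}(a;x;q)}{1+x}$. -}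

module Defs where

-- Formal Laurent series in three variables a, x, q over ℤ, with every
-- exponent bounded below (a commutative ring containing all objects of the paper).

open import Data.Nat as ℕ using (ℕ; zero; suc)
open import Data.Nat.Combinatorics using (_C_)
open import Data.Integer as ℤ using (ℤ; +_; -[1+_]; _+_; _*_; -_; _-_; _⊓_; _^_; ∣_∣)
open import Data.Bool using (Bool; true; false; if_then_else_; _∧_)
open import Relation.Nullary using (does)
open import Relation.Binary.PropositionalEquality using (_≡_)

pos : ℤ → ℕ
pos (+ n) = n
pos -[1+ n ] = 0

sumℕ : ℕ → (ℕ → ℤ) → ℤ
sumℕ zero    f = + 0
sumℕ (suc N) f = sumℕ N f + f N

sumℤ : ℤ → ℤ → (ℤ → ℤ) → ℤ
sumℤ lo hi f = sumℕ (pos (hi - lo + + 1)) (λ t → f (lo + + t))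

-- A series: lower bounds for the exponents of a, x, q (the coefficient
-- function vanishes below them) and the coefficient of a^A x^X q^Q.
record Ser : Set where
  constructor ser
  field
    loA loX loQ : ℤ
    coeff : ℤ → ℤ → ℤ → ℤ
open Ser public

_≈S_ : Ser → Ser → Set
f ≈S g = ∀ A X Q → coeff f A X Q ≡ coeff g A X Q

zeroS : Ser
zeroS = ser (+ 0) (+ 0) (+ 0) (λ _ _ _ → + 0)

mono : ℤ → ℤ → ℤ → ℤ → Ser
mono c α β γ = ser α β γ (λ A X Q →
  if does (A ℤ.≟ α) ∧ does (X ℤ.≟ β) ∧ does (Q ℤ.≟ γ) then c else + 0)

oneS : Ser
oneS = mono (+ 1) (+ 0) (+ 0) (+ 0)

infixl 6 _⊕_ _⊖_
infixl 7 _⊗_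

_⊕_ : Ser → Ser → Ser
f ⊕ g = ser (loA f ⊓ loA g) (loX f ⊓ loX g) (loQ f ⊓ loQ g)
            (λ A X Q → coeff f A X Q + coeff g A X Q)

negS : Ser → Ser
negS f = ser (loA f) (loX f) (loQ f) (λ A X Q → - coeff f A X Q)

_⊖_ : Ser → Ser → Ser
f ⊖ g = f ⊕ negS g

-- Cauchy product (a finite sum thanks to the lower bounds)
_⊗_ : Ser → Ser → Ser
f ⊗ g = ser (loA f + loA g) (loX f + loX g) (loQ f + loQ g) (λ A X Q →
  sumℤ (loA f) (A - loA g) (λ a′ →
  sumℤ (loX f) (X - loX g) (λ x′ →
  sumℤ (loQ f) (Q - loQ g) (λ q′ →
    coeff f a′ x′ q′ * coeff g (A - a′) (X - x′) (Q - q′)))))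

prodN : ℕ → (ℕ → Ser) → Ser
prodN zero    f = oneS
prodN (suc N) f = prodN N f ⊗ f N

-- geometric series 1/(1 - c a^α x^β q^γ) = Σ_j c^j a^{jα} x^{jβ} q^{jγ},
-- for natural exponents not all zero (so only j ≤ A+X+Q can contribute)
geom : ℤ → ℕ → ℕ → ℕ → Ser
geom c α β γ = ser (+ 0) (+ 0) (+ 0) (λ A X Q →
  sumℕ (suc (pos A ℕ.+ pos X ℕ.+ pos Q)) (λ j →
    if does (A ℤ.≟ + (j ℕ.* α)) ∧ does (X ℤ.≟ + (j ℕ.* β)) ∧ does (Q ℤ.≟ + (j ℕ.* γ))
    then c ^ j else + 0))

-- infinite product ∏_{m ≥ 0} f m, for factors with non-negative exponents and
-- f m ≡ 1 mod q^m: the coefficient of q^Q is that of ∏_{m ≤ Q} f m.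
qProd : (ℕ → Ser) → Ser
qProd f = ser (+ 0) (+ 0) (+ 0) (λ A X Q → coeff (prodN (suc (pos Q)) f) A X Q)

poch : ℤ → ℤ → ℤ → ℤ → ℕ → Ser
poch c α β γ n = prodN n (λ m → oneS ⊖ mono c α β (γ + + m))

-- (M;q)_∞  with  M = c a^α x^β q^γ  (used with α, β ≥ 0, γ ≥ 1)
pochInf : ℤ → ℤ → ℤ → ℤ → Ser
pochInf c α β γ = qProd (λ m → oneS ⊖ mono c α β (γ + + m))

invPochQ2 : ℕ → Ser
invPochQ2 n = prodN n (λ m → geom (+ 1) 0 0 (2 ℕ.+ 2 ℕ.* m))

invPochXInf : ℕ → Ser
invPochXInf n = qProd (λ m → geom (+ 1) 0 1 (n ℕ.+ m))

-- infinite sum Σ_{n ≥ 0} t n, given valid lower bounds for all terms and a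
-- bound B such that terms with n > B Q have no q^Q coefficient
qSum : ℤ → ℤ → ℤ → (ℤ → ℕ) → (ℕ → Ser) → Ser
qSum la lx lq B t = ser la lx lq (λ A X Q → sumℕ (suc (B Q)) (λ n → coeff (t n) A X Q))

Hterm : ℕ → ℤ → ℕ → Ser
Hterm k i n =
  mono ((- + 1) ^ n) (+ n) (+ 0) (+ 0)
  ⊗ mono (+ 1) (+ 0) (+ 0) (+ (k ℕ.* n ℕ.* n) - + (n C 2) + + n - i * + n)
  ⊗ mono (+ 1) (+ 0) (+ ((k ℕ.∸ 1) ℕ.* n)) (+ 0)
  ⊗ (oneS ⊖ mono (+ 1) (+ 0) i (+ (2 ℕ.* n) * i))
  ⊗ poch (- + 1) (+ 0) (+ 1) (+ 0) n
  ⊗ poch (- + 1) (- + 1) (+ 0) (+ 0) n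
  ⊗ pochInf (- + 1) (+ 1) (+ 1) (+ (suc n))
  ⊗ invPochQ2 n
  ⊗ invPochXInf n

-- H̃_{k,i}(a;x;q).  For k ≥ 2 every summand has q-exponents ≥ n² - |i| n,
-- so -|i|² bounds all q-exponents and only n ≤ |Q| + |i| contribute to q^Q.
Ht : ℕ → ℤ → Ser
Ht k i = qSum (+ 0) (+ 0 ⊓ i) (- (+ (∣ i ∣ ℕ.* ∣ i ∣)))
              (λ Q → ∣ Q ∣ ℕ.+ ∣ i ∣) (Hterm k i)

xpow : ℤ → Ser
xpow e = mono (+ 1) (+ 0) e (+ 0)

-- H̃̃_{k,i} = (H̃_{k,i+1} + x H̃_{k,i-1}) / (1 + x),  1/(1+x) = Σ (-x)^j
Htt : ℕ → ℤ → Ser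
Htt k i = (Ht k (i + + 1) ⊕ xpow (+ 1) ⊗ Ht k (i - + 1)) ⊗ geom (- + 1) 0 1 0

-- Term by term, the n-th summand of H̃_{k,-i} is -x^{-i} times the n-th summand of H̃_{k,i}:
-- replacing i by -i multiplies q^{kn²-C(n,2)+n-in} by q^{2in}, and
-- q^{2in} (1 - x^{-i} q^{-2in}) = -x^{-i} (1 - x^i q^{2in}), while no other factor depends on i.
-- Hence H̃_{k,-i} = -x^{-i} H̃_{k,i}. In the numerator of H̃̃_{k,-i} the two terms H̃_{k,-i+1} and
-- x H̃_{k,-i-1} then become -x^{-i} (x H̃_{k,i-1}) and -x^{-i} H̃_{k,i+1}, so H̃̃_{k,-i} = -x^{-i} H̃̃_{k,i},
-- and i = 0 gives H̃̃_{k,0} = -H̃̃_{k,0} = 0.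
-- For formal series, "f = c a^α x^β q^γ g" is a shift of the coefficients and of the lower bounds,
-- and it is pushed through the products factor by factor. The one place where k ≥ 2 enters is the
-- validity of the lower bound -i² declared for the q-exponents of H̃_{k,i}:
-- kn² - C(n,2) + n ≥ n² and n² - |i|n ≥ -i².

module Submission where

open import Defs
open import Data.Nat using (ℕ; _≤_)
open import Data.Integer using (ℤ; +_; -_)
open import Data.Product using (_×_)

import Data.Integer.Properties as ℤₚ
open import Algebra.Properties.AbelianGroup ℤₚ.+-0-abelianGroup using (∙-cancelˡ)
open import Data.Bool using (if_then_else_; _∧_)
open import Data.Bool.Properties using (∧-zeroʳ)
open import Data.Empty using (⊥-elim)
open import Data.Integer as ℤ using (-[1+_]; _+_; _*_; _-_; _⊓_; ∣_∣)
open import Data.Integer.Tactic.RingSolver using (solve-∀)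
open import Data.Nat as ℕ using (zero; suc)
open import Data.Nat.Combinatorics using (_C_; nC1≡n; nCk+nC[k+1]≡[n+1]C[k+1])
import Data.Nat.Properties as ℕₚ
open import Data.Nat.Tactic.RingSolver using () renaming (solve-∀ to ℕ-solve-∀)
open import Data.Product using (_,_; ∃)
open import Data.Sum using (_⊎_; inj₁; inj₂)
import Data.Sum as Sum
open import Function using (_∘_)
open import Function.Bundles using (mk⇔)
open import Relation.Binary.PropositionalEquality
open import Relation.Nullary using (yes; no; does)
open import Relation.Nullary.Decidable using (dec-true; dec-false; does-⇔)
open ≡-Reasoning

cong₃ : ∀ {A B C D : Set} (f : A → B → C → D) {a a′ b b′ c c′} →
        a ≡ a′ → b ≡ b′ → c ≡ c′ → f a b c ≡ f a′ b′ c′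
cong₃ f refl refl refl = refl

sumℕ-cong : ∀ N {f g : ℕ → ℤ} → (∀ t → f t ≡ g t) → sumℕ N f ≡ sumℕ N g
sumℕ-cong zero    f≗g = refl
sumℕ-cong (suc N) f≗g = cong₂ _+_ (sumℕ-cong N f≗g) (f≗g N)

sumℕ-zero : ∀ N {f : ℕ → ℤ} → (∀ t → t ℕ.< N → f t ≡ + 0) → sumℕ N f ≡ + 0
sumℕ-zero zero    f≡0 = refl
sumℕ-zero (suc N) f≡0 =
  cong₂ _+_ (sumℕ-zero N (λ t t<N → f≡0 t (ℕₚ.m<n⇒m<1+n t<N))) (f≡0 N ℕₚ.≤-refl)

sumℕ-+ : ∀ N (f g : ℕ → ℤ) → sumℕ N (λ t → f t + g t) ≡ sumℕ N f + sumℕ N g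
sumℕ-+ zero    f g = refl
sumℕ-+ (suc N) f g =
  trans (cong (_+ (f N + g N)) (sumℕ-+ N f g)) (interchange (sumℕ N f) (sumℕ N g) (f N) (g N))
  where
  interchange : ∀ a b c d → (a + b) + (c + d) ≡ (a + c) + (b + d)
  interchange = solve-∀

sumℕ-*ˡ : ∀ N c (f : ℕ → ℤ) → sumℕ N (λ t → c * f t) ≡ c * sumℕ N f
sumℕ-*ˡ zero    c f = sym (ℤₚ.*-zeroʳ c)
sumℕ-*ˡ (suc N) c f =
  trans (cong (_+ c * f N) (sumℕ-*ˡ N c f)) (sym (ℤₚ.*-distribˡ-+ c (sumℕ N f) (f N)))

sumℕ-single : ∀ N {f : ℕ → ℤ} m → m ℕ.< N → (∀ t → t ≢ m → f t ≡ + 0) → sumℕ N f ≡ f m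
sumℕ-single (suc N) {f} m m<1+N f≡0 with m ℕ.≟ N
... | yes refl = trans (cong (_+ f m) (sumℕ-zero N (λ t t<m → f≡0 t (ℕₚ.<⇒≢ t<m))))
                       (ℤₚ.+-identityˡ (f m))
... | no m≢N = trans (cong₂ _+_ (sumℕ-single N m (ℕₚ.≤∧≢⇒< (ℕₚ.≤-pred m<1+N) m≢N) f≡0)
                                (f≡0 N (m≢N ∘ sym)))
                     (ℤₚ.+-identityʳ (f m))

pos-≤0 : ∀ {i} → i ℤ.≤ + 0 → pos i ≡ 0
pos-≤0 {+ zero}    _          = refl
pos-≤0 {+ suc n}   (ℤ.+≤+ ())
pos-≤0 { -[1+ n ]} _          = refl

≤-pos : ∀ i → i ℤ.≤ + pos i
≤-pos (+ n)    = ℤₚ.≤-refl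
≤-pos -[1+ n ] = ℤ.-≤+

≤⇒≡+ : ∀ {i j} → i ℤ.≤ j → ∃ λ m → j ≡ i + + m
≤⇒≡+ {i} {j} i≤j = ∣ j - i ∣ , (begin
  j               ≡⟨ j≡i+[j-i] i j ⟩
  i + (j - i)     ≡⟨ cong (λ d → i + d) (ℤₚ.0≤i⇒+∣i∣≡i (ℤₚ.i≤j⇒0≤j-i i≤j)) ⟨
  i + + ∣ j - i ∣ ∎)
  where
  j≡i+[j-i] : ∀ i j → j ≡ i + (j - i)
  j≡i+[j-i] = solve-∀

sumℤ-cong : ∀ lo hi {f g : ℤ → ℤ} → (∀ t → f t ≡ g t) → sumℤ lo hi f ≡ sumℤ lo hi g
sumℤ-cong lo hi f≗g = sumℕ-cong (pos (hi - lo + + 1)) (λ t → f≗g (lo + + t))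

sumℤ-zero : ∀ lo hi {f : ℤ → ℤ} → (∀ t → f t ≡ + 0) → sumℤ lo hi f ≡ + 0
sumℤ-zero lo hi f≡0 = sumℕ-zero (pos (hi - lo + + 1)) (λ t _ → f≡0 (lo + + t))

sumℤ-+ : ∀ lo hi (f g : ℤ → ℤ) → sumℤ lo hi (λ t → f t + g t) ≡ sumℤ lo hi f + sumℤ lo hi g
sumℤ-+ lo hi f g = sumℕ-+ (pos (hi - lo + + 1)) (λ t → f (lo + + t)) (λ t → g (lo + + t))

sumℤ-*ˡ : ∀ lo hi c (f : ℤ → ℤ) → sumℤ lo hi (λ t → c * f t) ≡ c * sumℤ lo hi f
sumℤ-*ˡ lo hi c f = sumℕ-*ˡ (pos (hi - lo + + 1)) c (λ t → f (lo + + t))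

sumℤ-empty : ∀ lo hi (f : ℤ → ℤ) → hi ℤ.< lo → sumℤ lo hi f ≡ + 0
sumℤ-empty lo hi f hi<lo = cong (λ N → sumℕ N (λ t → f (lo + + t))) (pos-≤0 length≤0)
  where
  rearrange : ∀ hi lo → (+ 1 + hi) - lo ≡ hi - lo + + 1
  rearrange = solve-∀
  length≤0 : hi - lo + + 1 ℤ.≤ + 0
  length≤0 = subst (ℤ._≤ + 0) (rearrange hi lo) (ℤₚ.i≤j⇒i-j≤0 (ℤₚ.i<j⇒suc[i]≤j hi<lo))

sumℤ-delta : ∀ lo hi p {f : ℤ → ℤ} → (∀ t → t ≢ p → f t ≡ + 0) →
             (p ℤ.< lo ⊎ hi ℤ.< p → f p ≡ + 0) → sumℤ lo hi f ≡ f p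
sumℤ-delta lo hi p {f} f≡0 outside with p ℤ.<? lo
... | yes p<lo =
  trans (sumℕ-zero (pos (hi - lo + + 1)) (λ t _ → f≡0 (lo + + t) (lo+t≢p t))) (sym (outside (inj₁ p<lo)))
  where
  lo+t≢p : ∀ t → lo + + t ≢ p
  lo+t≢p t = ℤₚ.<⇒≢ (ℤₚ.<-≤-trans p<lo (ℤₚ.i≤i+j lo (+ t))) ∘ sym
... | no p≮lo with ≤⇒≡+ (ℤₚ.≮⇒≥ p≮lo)
...   | m , refl with m ℕ.<? pos (hi - lo + + 1)
...     | yes m<N =
  sumℕ-single (pos (hi - lo + + 1)) m m<N
              (λ t t≢m → f≡0 (lo + + t) (t≢m ∘ ℤₚ.+-injective ∘ ∙-cancelˡ lo _ _))
...     | no m≮N =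
  trans (sumℕ-zero N (λ t t<N → f≡0 (lo + + t) (lo+t≢lo+m t<N))) (sym (outside (inj₂ hi<lo+m)))
  where
  N = pos (hi - lo + + 1)
  lo+t≢lo+m : ∀ {t} → t ℕ.< N → lo + + t ≢ lo + + m
  lo+t≢lo+m t<N = ℕₚ.<⇒≢ (ℕₚ.<-≤-trans t<N (ℕₚ.≮⇒≥ m≮N)) ∘ ℤₚ.+-injective ∘ ∙-cancelˡ lo _ _
  rearrange : ∀ hi lo → (hi - lo + + 1) + lo ≡ + 1 + hi
  rearrange = solve-∀
  hi<lo+m : hi ℤ.< lo + + m
  hi<lo+m = ℤₚ.suc[i]≤j⇒i<j (subst₂ ℤ._≤_ (rearrange hi lo) (ℤₚ.+-comm (+ m) lo)
              (ℤₚ.+-monoˡ-≤ lo (ℤₚ.≤-trans (≤-pos (hi - lo + + 1)) (ℤ.+≤+ (ℕₚ.≮⇒≥ m≮N)))))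

sumℤ-shift : ∀ lo hi e (f : ℤ → ℤ) → sumℤ (lo + e) (hi + e) f ≡ sumℤ lo hi (λ t → f (t + e))
sumℤ-shift lo hi e f =
  trans (cong (λ L → sumℕ (pos L) (λ t → f ((lo + e) + + t))) (same-length hi lo e))
        (sumℕ-cong (pos (hi - lo + + 1)) (λ t → cong f (reorder lo e (+ t))))
  where
  same-length : ∀ hi lo e → (hi + e) - (lo + e) + + 1 ≡ hi - lo + + 1
  same-length = solve-∀
  reorder : ∀ lo e t → (lo + e) + t ≡ (lo + t) + e
  reorder = solve-∀

sum³ : (lA hA lX hX lQ hQ : ℤ) → (ℤ → ℤ → ℤ → ℤ) → ℤ
sum³ lA hA lX hX lQ hQ Φ = sumℤ lA hA λ a → sumℤ lX hX λ x → sumℤ lQ hQ λ q → Φ a x q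

module Box (lA hA lX hX lQ hQ : ℤ) where

  Outside : ℤ → ℤ → ℤ → Set
  Outside a x q = (a ℤ.< lA ⊎ hA ℤ.< a) ⊎ (x ℤ.< lX ⊎ hX ℤ.< x) ⊎ (q ℤ.< lQ ⊎ hQ ℤ.< q)

  sum³-cong : ∀ {Φ Ψ : ℤ → ℤ → ℤ → ℤ} → (∀ a x q → Φ a x q ≡ Ψ a x q) →
              sum³ lA hA lX hX lQ hQ Φ ≡ sum³ lA hA lX hX lQ hQ Ψ
  sum³-cong Φ≗Ψ = sumℤ-cong lA hA λ a → sumℤ-cong lX hX λ x → sumℤ-cong lQ hQ λ q → Φ≗Ψ a x q

  sum³-+ : ∀ (Φ Ψ : ℤ → ℤ → ℤ → ℤ) →
           sum³ lA hA lX hX lQ hQ (λ a x q → Φ a x q + Ψ a x q) ≡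
           sum³ lA hA lX hX lQ hQ Φ + sum³ lA hA lX hX lQ hQ Ψ
  sum³-+ Φ Ψ =
    trans (sumℤ-cong lA hA λ a →
             trans (sumℤ-cong lX hX λ x → sumℤ-+ lQ hQ (Φ a x) (Ψ a x))
                   (sumℤ-+ lX hX (λ x → sumℤ lQ hQ (Φ a x)) (λ x → sumℤ lQ hQ (Ψ a x))))
          (sumℤ-+ lA hA (λ a → sumℤ lX hX λ x → sumℤ lQ hQ (Φ a x))
                        (λ a → sumℤ lX hX λ x → sumℤ lQ hQ (Ψ a x)))

  sum³-*ˡ : ∀ c (Φ : ℤ → ℤ → ℤ → ℤ) →
            sum³ lA hA lX hX lQ hQ (λ a x q → c * Φ a x q) ≡ c * sum³ lA hA lX hX lQ hQ Φ
  sum³-*ˡ c Φ =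
    trans (sumℤ-cong lA hA λ a →
             trans (sumℤ-cong lX hX λ x → sumℤ-*ˡ lQ hQ c (Φ a x))
                   (sumℤ-*ˡ lX hX c (λ x → sumℤ lQ hQ (Φ a x))))
          (sumℤ-*ˡ lA hA c (λ a → sumℤ lX hX λ x → sumℤ lQ hQ (Φ a x)))

  sum³-empty : ∀ (Φ : ℤ → ℤ → ℤ → ℤ) → hA ℤ.< lA ⊎ hX ℤ.< lX ⊎ hQ ℤ.< lQ →
               sum³ lA hA lX hX lQ hQ Φ ≡ + 0
  sum³-empty Φ (inj₁ emptyA) =
    sumℤ-empty lA hA (λ a → sumℤ lX hX λ x → sumℤ lQ hQ (Φ a x)) emptyA
  sum³-empty Φ (inj₂ (inj₁ emptyX)) =
    sumℤ-zero lA hA λ a → sumℤ-empty lX hX (λ x → sumℤ lQ hQ (Φ a x)) emptyX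
  sum³-empty Φ (inj₂ (inj₂ emptyQ)) =
    sumℤ-zero lA hA λ a → sumℤ-zero lX hX λ x → sumℤ-empty lQ hQ (Φ a x) emptyQ

  sum³-delta : ∀ p r s (Φ : ℤ → ℤ → ℤ → ℤ) →
               (∀ a x q → a ≢ p ⊎ x ≢ r ⊎ q ≢ s → Φ a x q ≡ + 0) →
               (Outside p r s → Φ p r s ≡ + 0) →
               sum³ lA hA lX hX lQ hQ Φ ≡ Φ p r s
  sum³-delta p r s Φ Φ≡0 outside = trans
    (sumℤ-delta lA hA p (λ a a≢p → sumℤ-zero lX hX λ x → sumℤ-zero lQ hQ λ q → Φ≡0 a x q (inj₁ a≢p))
                        (λ out → trans sumXQ (outside (inj₁ out))))
    sumXQ
    where
    sumQ : sumℤ lQ hQ (Φ p r) ≡ Φ p r s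
    sumQ = sumℤ-delta lQ hQ s (λ q q≢s → Φ≡0 p r q (inj₂ (inj₂ q≢s))) (outside ∘ inj₂ ∘ inj₂)
    sumXQ : sumℤ lX hX (λ x → sumℤ lQ hQ (Φ p x)) ≡ Φ p r s
    sumXQ = trans
      (sumℤ-delta lX hX r (λ x x≢r → sumℤ-zero lQ hQ λ q → Φ≡0 p x q (inj₂ (inj₁ x≢r)))
                          (λ out → trans sumQ (outside (inj₂ (inj₁ out)))))
      sumQ

sum³-shift : ∀ lA hA lX hX lQ hQ eA eX eQ (Φ : ℤ → ℤ → ℤ → ℤ) {lA′ hA′ lX′ hX′ lQ′ hQ′} →
  lA′ ≡ lA + eA → hA′ ≡ hA + eA → lX′ ≡ lX + eX → hX′ ≡ hX + eX → lQ′ ≡ lQ + eQ → hQ′ ≡ hQ + eQ →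
  sum³ lA′ hA′ lX′ hX′ lQ′ hQ′ Φ ≡ sum³ lA hA lX hX lQ hQ (λ a x q → Φ (a + eA) (x + eX) (q + eQ))
sum³-shift lA hA lX hX lQ hQ eA eX eQ Φ refl refl refl refl refl refl =
  trans (sumℤ-shift lA hA eA (λ a → sumℤ (lX + eX) (hX + eX) λ x → sumℤ (lQ + eQ) (hQ + eQ) (Φ a x)))
        (sumℤ-cong lA hA λ a →
           trans (sumℤ-shift lX hX eX (λ x → sumℤ (lQ + eQ) (hQ + eQ) (Φ (a + eA) x)))
                 (sumℤ-cong lX hX λ x → sumℤ-shift lQ hQ eQ (Φ (a + eA) (x + eX))))

-- Nothing in Ser forces the coefficients to vanish below the declared lower bounds.
Valid : Ser → Set
Valid f = ∀ A X Q → A ℤ.< loA f ⊎ X ℤ.< loX f ⊎ Q ℤ.< loQ f → coeff f A X Q ≡ + 0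

⊗-term : Ser → Ser → ℤ → ℤ → ℤ → ℤ → ℤ → ℤ → ℤ
⊗-term f g A X Q a x q = coeff f a x q * coeff g (A - a) (X - x) (Q - q)

<-minus : ∀ {i j l} → i ℤ.< j + l → i - l ℤ.< j
<-minus {i} {j} {l} i<j+l = subst (i - l ℤ.<_) (cancel j l) (ℤₚ.+-monoˡ-< (- l) i<j+l)
  where
  cancel : ∀ j l → (j + l) - l ≡ j
  cancel = solve-∀

valid-⊗ : ∀ f g → Valid (f ⊗ g)
valid-⊗ f g A X Q below =
  Box.sum³-empty (loA f) (A - loA g) (loX f) (X - loX g) (loQ f) (Q - loQ g) (⊗-term f g A X Q)
                 (Sum.map <-minus (Sum.map <-minus <-minus) below)

zero-* : ∀ {a} b → a ≡ + 0 → a * b ≡ + 0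
zero-* b refl = ℤₚ.*-zeroˡ b

*-zero : ∀ a {b} → b ≡ + 0 → a * b ≡ + 0
*-zero a refl = ℤₚ.*-zeroʳ a

mono-≡ : ∀ c α β γ → coeff (mono c α β γ) α β γ ≡ c
mono-≡ c α β γ
  rewrite dec-true (α ℤ.≟ α) refl | dec-true (β ℤ.≟ β) refl | dec-true (γ ℤ.≟ γ) refl = refl

mono-≢ : ∀ c α β γ {A X Q} → A ≢ α ⊎ X ≢ β ⊎ Q ≢ γ → coeff (mono c α β γ) A X Q ≡ + 0
mono-≢ c α β γ {A} {X} {Q} (inj₁ A≢α) rewrite dec-false (A ℤ.≟ α) A≢α = refl
mono-≢ c α β γ {A} {X} {Q} (inj₂ (inj₁ X≢β))
  rewrite dec-false (X ℤ.≟ β) X≢β | ∧-zeroʳ (does (A ℤ.≟ α)) = refl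
mono-≢ c α β γ {A} {X} {Q} (inj₂ (inj₂ Q≢γ))
  rewrite dec-false (Q ℤ.≟ γ) Q≢γ | ∧-zeroʳ (does (X ℤ.≟ β)) | ∧-zeroʳ (does (A ℤ.≟ α)) = refl

valid-mono : ∀ c α β γ → Valid (mono c α β γ)
valid-mono c α β γ A X Q below = mono-≢ c α β γ (Sum.map ℤₚ.<⇒≢ (Sum.map ℤₚ.<⇒≢ ℤₚ.<⇒≢) below)

minus-swap-< : ∀ {i j l} → i - j ℤ.< l → i - l ℤ.< j
minus-swap-< {i} {j} {l} i-j<l =
  subst₂ ℤ._<_ (shift i j l) (cancel j l) (ℤₚ.+-monoˡ-< (j - l) i-j<l)
  where
  shift : ∀ i j l → (i - j) + (j - l) ≡ i - l
  shift = solve-∀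
  cancel : ∀ j l → l + (j - l) ≡ j
  cancel = solve-∀

minus-minus : ∀ i j → i - (i - j) ≡ j
minus-minus = solve-∀

minus-swap-≢ : ∀ {i j l} → j ≢ i - l → i - j ≢ l
minus-swap-≢ {i} {j} {l} j≢i-l i-j≡l = j≢i-l (trans (sym (minus-minus i j)) (cong (λ d → i - d) i-j≡l))

minus-mono-≤ : ∀ i {j l} → j ℤ.≤ l → i - l ℤ.≤ i - j
minus-mono-≤ i j≤l = ℤₚ.+-monoʳ-≤ i (ℤₚ.neg-mono-≤ j≤l)

coeff-mono-⊗ : ∀ c α β γ f → Valid f → ∀ A X Q →
  coeff (mono c α β γ ⊗ f) A X Q ≡ c * coeff f (A - α) (X - β) (Q - γ)
coeff-mono-⊗ c α β γ f valid A X Q =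
  trans (sum³-delta α β γ (⊗-term (mono c α β γ) f A X Q)
                    (λ a x q off → zero-* _ (mono-≢ c α β γ off)) outside)
        (cong (_* coeff f (A - α) (X - β) (Q - γ)) (mono-≡ c α β γ))
  where
  open Box α (A - loA f) β (X - loX f) γ (Q - loQ f)
  m = coeff (mono c α β γ) α β γ
  vanish : A - α ℤ.< loA f ⊎ X - β ℤ.< loX f ⊎ Q - γ ℤ.< loQ f →
           m * coeff f (A - α) (X - β) (Q - γ) ≡ + 0
  vanish below = *-zero m (valid (A - α) (X - β) (Q - γ) below)
  outside : Outside α β γ → m * coeff f (A - α) (X - β) (Q - γ) ≡ + 0
  outside (inj₁ (inj₁ α<α))          = ⊥-elim (ℤₚ.<-irrefl refl α<α)
  outside (inj₁ (inj₂ above))        = vanish (inj₁ (minus-swap-< {A} above))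
  outside (inj₂ (inj₁ (inj₁ β<β)))   = ⊥-elim (ℤₚ.<-irrefl refl β<β)
  outside (inj₂ (inj₁ (inj₂ above))) = vanish (inj₂ (inj₁ (minus-swap-< {X} above)))
  outside (inj₂ (inj₂ (inj₁ γ<γ)))   = ⊥-elim (ℤₚ.<-irrefl refl γ<γ)
  outside (inj₂ (inj₂ (inj₂ above))) = vanish (inj₂ (inj₂ (minus-swap-< {Q} above)))

-- The box is that of a product with oneS ⊖ mono c α β γ, whose lower bounds are 0 ⊓ α, 0 ⊓ β, 0 ⊓ γ.
sum³-⊗-mono : ∀ f → Valid f → ∀ c α β γ {lA lX lQ} → lA ℤ.≤ α → lX ℤ.≤ β → lQ ℤ.≤ γ → ∀ A X Q →
  sum³ (loA f) (A - lA) (loX f) (X - lX) (loQ f) (Q - lQ) (⊗-term f (mono c α β γ) A X Q) ≡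
  coeff f (A - α) (X - β) (Q - γ) * c
sum³-⊗-mono f valid c α β γ {lA} {lX} {lQ} lA≤α lX≤β lQ≤γ A X Q =
  trans (sum³-delta (A - α) (X - β) (Q - γ) (⊗-term f (mono c α β γ) A X Q) off outside)
        (cong (coeff f (A - α) (X - β) (Q - γ) *_)
              (trans (cong₃ (coeff (mono c α β γ)) (minus-minus A α) (minus-minus X β) (minus-minus Q γ))
                     (mono-≡ c α β γ)))
  where
  open Box (loA f) (A - lA) (loX f) (X - lX) (loQ f) (Q - lQ)
  off : ∀ a x q → a ≢ A - α ⊎ x ≢ X - β ⊎ q ≢ Q - γ → ⊗-term f (mono c α β γ) A X Q a x q ≡ + 0
  off a x q ne = *-zero (coeff f a x q)
    (mono-≢ c α β γ (Sum.map (minus-swap-≢ {A}) (Sum.map (minus-swap-≢ {X}) (minus-swap-≢ {Q})) ne))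
  vanish : A - α ℤ.< loA f ⊎ X - β ℤ.< loX f ⊎ Q - γ ℤ.< loQ f →
           ⊗-term f (mono c α β γ) A X Q (A - α) (X - β) (Q - γ) ≡ + 0
  vanish below = zero-* _ (valid (A - α) (X - β) (Q - γ) below)
  outside : Outside (A - α) (X - β) (Q - γ) → ⊗-term f (mono c α β γ) A X Q (A - α) (X - β) (Q - γ) ≡ + 0
  outside (inj₁ (inj₁ below))        = vanish (inj₁ below)
  outside (inj₁ (inj₂ above))        = ⊥-elim (ℤₚ.<⇒≱ above (minus-mono-≤ A lA≤α))
  outside (inj₂ (inj₁ (inj₁ below))) = vanish (inj₂ (inj₁ below))
  outside (inj₂ (inj₁ (inj₂ above))) = ⊥-elim (ℤₚ.<⇒≱ above (minus-mono-≤ X lX≤β))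
  outside (inj₂ (inj₂ (inj₁ below))) = vanish (inj₂ (inj₂ below))
  outside (inj₂ (inj₂ (inj₂ above))) = ⊥-elim (ℤₚ.<⇒≱ above (minus-mono-≤ Q lQ≤γ))

coeff-⊗-one-minus : ∀ f → Valid f → ∀ α β γ A X Q →
  coeff (f ⊗ (oneS ⊖ mono (+ 1) α β γ)) A X Q ≡ coeff f A X Q - coeff f (A - α) (X - β) (Q - γ)
coeff-⊗-one-minus f valid α β γ A X Q = begin
    S (⊗-term f (oneS ⊖ M) A X Q)
  ≡⟨ sum³-cong (λ a x q → split (coeff f a x q) (coeff oneS (A - a) (X - x) (Q - q))
                                (coeff M (A - a) (X - x) (Q - q))) ⟩
    S (λ a x q → ⊗-term f oneS A X Q a x q + - + 1 * ⊗-term f M A X Q a x q)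
  ≡⟨ sum³-+ (⊗-term f oneS A X Q) (λ a x q → - + 1 * ⊗-term f M A X Q a x q) ⟩
    S (⊗-term f oneS A X Q) + S (λ a x q → - + 1 * ⊗-term f M A X Q a x q)
  ≡⟨ cong (λ v → S (⊗-term f oneS A X Q) + v) (sum³-*ˡ (- + 1) (⊗-term f M A X Q)) ⟩
    S (⊗-term f oneS A X Q) + - + 1 * S (⊗-term f M A X Q)
  ≡⟨ cong₂ (λ u v → u + - + 1 * v)
       (sum³-⊗-mono f valid (+ 1) (+ 0) (+ 0) (+ 0) (ℤₚ.i⊓j≤i _ _) (ℤₚ.i⊓j≤i _ _) (ℤₚ.i⊓j≤i _ _) A X Q)
       (sum³-⊗-mono f valid (+ 1) α β γ (ℤₚ.i⊓j≤j _ _) (ℤₚ.i⊓j≤j _ _) (ℤₚ.i⊓j≤j _ _) A X Q) ⟩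
    coeff f (A - + 0) (X - + 0) (Q - + 0) * + 1 + - + 1 * (coeff f (A - α) (X - β) (Q - γ) * + 1)
  ≡⟨ cong (λ u → u * + 1 + - + 1 * (coeff f (A - α) (X - β) (Q - γ) * + 1))
          (cong₃ (coeff f) (ℤₚ.+-identityʳ A) (ℤₚ.+-identityʳ X) (ℤₚ.+-identityʳ Q)) ⟩
    coeff f A X Q * + 1 + - + 1 * (coeff f (A - α) (X - β) (Q - γ) * + 1)
  ≡⟨ simplify (coeff f A X Q) (coeff f (A - α) (X - β) (Q - γ)) ⟩
    coeff f A X Q - coeff f (A - α) (X - β) (Q - γ) ∎
  where
  M = mono (+ 1) α β γ
  open Box (loA f) (A - (+ 0 ⊓ α)) (loX f) (X - (+ 0 ⊓ β)) (loQ f) (Q - (+ 0 ⊓ γ))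
  S : (ℤ → ℤ → ℤ → ℤ) → ℤ
  S = sum³ (loA f) (A - (+ 0 ⊓ α)) (loX f) (X - (+ 0 ⊓ β)) (loQ f) (Q - (+ 0 ⊓ γ))
  split : ∀ u v w → u * (v + - w) ≡ u * v + - + 1 * (u * w)
  split = solve-∀
  simplify : ∀ u v → u * + 1 + - + 1 * (v * + 1) ≡ u - v
  simplify = solve-∀

-- Shift c α β γ f g says f = c a^α x^β q^γ g, including the declared lower bounds; tracking the
-- bounds exactly is what lets the relation pass through ⊗ without any associativity law for ⊗.
record Shift (c α β γ : ℤ) (f g : Ser) : Set where
  field
    loA-shift : loA f ≡ loA g + α
    loX-shift : loX f ≡ loX g + β
    loQ-shift : loQ f ≡ loQ g + γ
    coeff-shift : ∀ A X Q → coeff f A X Q ≡ c * coeff g (A - α) (X - β) (Q - γ)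
open Shift

Shift-⊗ʳ : ∀ {c α β γ f g} → Shift c α β γ f g → ∀ h → Shift c α β γ (f ⊗ h) (g ⊗ h)
Shift-⊗ʳ {c} {α} {β} {γ} {f} {g} f≈g h = record
  { loA-shift = trans (cong (_+ loA h) (loA-shift f≈g)) (swap (loA g) α (loA h))
  ; loX-shift = trans (cong (_+ loX h) (loX-shift f≈g)) (swap (loX g) β (loX h))
  ; loQ-shift = trans (cong (_+ loQ h) (loQ-shift f≈g)) (swap (loQ g) γ (loQ h))
  ; coeff-shift = coeff-⊗-shift
  }
  where
  swap : ∀ l e m → (l + e) + m ≡ (l + m) + e
  swap = solve-∀
  upper : ∀ A e l → A - l ≡ ((A - e) - l) + e
  upper = solve-∀
  cancel : ∀ a e → (a + e) - e ≡ a
  cancel = solve-∀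
  reassoc : ∀ A a e → A - (a + e) ≡ (A - e) - a
  reassoc = solve-∀

  coeff-⊗-shift : ∀ A X Q → coeff (f ⊗ h) A X Q ≡ c * coeff (g ⊗ h) (A - α) (X - β) (Q - γ)
  coeff-⊗-shift A X Q = begin
      coeff (f ⊗ h) A X Q
    ≡⟨ sum³-shift (loA g) (A′ - loA h) (loX g) (X′ - loX h) (loQ g) (Q′ - loQ h) α β γ
                  (⊗-term f h A X Q) (loA-shift f≈g) (upper A α (loA h)) (loX-shift f≈g)
                  (upper X β (loX h)) (loQ-shift f≈g) (upper Q γ (loQ h)) ⟩
      sum³ (loA g) (A′ - loA h) (loX g) (X′ - loX h) (loQ g) (Q′ - loQ h)
           (λ a x q → ⊗-term f h A X Q (a + α) (x + β) (q + γ))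
    ≡⟨ sum³-cong term-shift ⟩
      sum³ (loA g) (A′ - loA h) (loX g) (X′ - loX h) (loQ g) (Q′ - loQ h)
           (λ a x q → c * ⊗-term g h A′ X′ Q′ a x q)
    ≡⟨ sum³-*ˡ c (⊗-term g h A′ X′ Q′) ⟩
      c * coeff (g ⊗ h) A′ X′ Q′ ∎
    where
    A′ = A - α
    X′ = X - β
    Q′ = Q - γ
    open Box (loA g) (A′ - loA h) (loX g) (X′ - loX h) (loQ g) (Q′ - loQ h)
    term-shift : ∀ a x q → ⊗-term f h A X Q (a + α) (x + β) (q + γ) ≡ c * ⊗-term g h A′ X′ Q′ a x q
    term-shift a x q = begin
        coeff f (a + α) (x + β) (q + γ) * coeff h (A - (a + α)) (X - (x + β)) (Q - (q + γ))
      ≡⟨ cong₂ _*_ (coeff-shift f≈g (a + α) (x + β) (q + γ))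
                   (cong₃ (coeff h) (reassoc A a α) (reassoc X x β) (reassoc Q q γ)) ⟩
        c * coeff g ((a + α) - α) ((x + β) - β) ((q + γ) - γ) * coeff h (A′ - a) (X′ - x) (Q′ - q)
      ≡⟨ cong (λ v → c * v * coeff h (A′ - a) (X′ - x) (Q′ - q))
              (cong₃ (coeff g) (cancel a α) (cancel x β) (cancel q γ)) ⟩
        c * coeff g a x q * coeff h (A′ - a) (X′ - x) (Q′ - q)
      ≡⟨ ℤₚ.*-assoc c (coeff g a x q) (coeff h (A′ - a) (X′ - x) (Q′ - q)) ⟩
        c * ⊗-term g h A′ X′ Q′ a x q ∎

Shift-mono-⊗ : ∀ {c α β γ f g} → Shift c α β γ f g → Valid f → Valid g → ∀ c′ a x q →
               Shift c α β γ (mono c′ a x q ⊗ f) (mono c′ a x q ⊗ g)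
Shift-mono-⊗ {c} {α} {β} {γ} {f} {g} f≈g valid-f valid-g c′ a x q = record
  { loA-shift = trans (cong (λ l → a + l) (loA-shift f≈g)) (sym (ℤₚ.+-assoc a (loA g) α))
  ; loX-shift = trans (cong (λ l → x + l) (loX-shift f≈g)) (sym (ℤₚ.+-assoc x (loX g) β))
  ; loQ-shift = trans (cong (λ l → q + l) (loQ-shift f≈g)) (sym (ℤₚ.+-assoc q (loQ g) γ))
  ; coeff-shift = λ A X Q → begin
      coeff (mono c′ a x q ⊗ f) A X Q
    ≡⟨ coeff-mono-⊗ c′ a x q f valid-f A X Q ⟩
      c′ * coeff f (A - a) (X - x) (Q - q)
    ≡⟨ cong (c′ *_) (coeff-shift f≈g (A - a) (X - x) (Q - q)) ⟩
      c′ * (c * coeff g (A - a - α) (X - x - β) (Q - q - γ))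
    ≡⟨ cong (λ v → c′ * (c * v)) (cong₃ (coeff g) (swap A a α) (swap X x β) (swap Q q γ)) ⟩
      c′ * (c * coeff g (A - α - a) (X - β - x) (Q - γ - q))
    ≡⟨ *-left-comm c′ c _ ⟩
      c * (c′ * coeff g (A - α - a) (X - β - x) (Q - γ - q))
    ≡⟨ cong (c *_) (coeff-mono-⊗ c′ a x q g valid-g (A - α) (X - β) (Q - γ)) ⟨
      c * coeff (mono c′ a x q ⊗ g) (A - α) (X - β) (Q - γ) ∎
  }
  where
  swap : ∀ A a e → A - a - e ≡ A - e - a
  swap = solve-∀
  *-left-comm : ∀ u v w → u * (v * w) ≡ v * (u * w)
  *-left-comm = solve-∀

does-≟-shift : ∀ A a e → does (A ℤ.≟ a + e) ≡ does (A - e ℤ.≟ a)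
does-≟-shift A a e = does-⇔ (mk⇔ (λ eq → trans (cong (_- e) eq) (cancel a e))
                                  (λ eq → trans (sym (uncancel A e)) (cong (_+ e) eq)))
                             (A ℤ.≟ a + e) (A - e ℤ.≟ a)
  where
  cancel : ∀ a e → (a + e) - e ≡ a
  cancel = solve-∀
  uncancel : ∀ A e → (A - e) + e ≡ A
  uncancel = solve-∀

mono-Shift : ∀ c a x q α β γ {a′ x′ q′} → a′ ≡ a + α → x′ ≡ x + β → q′ ≡ q + γ →
             Shift (+ 1) α β γ (mono c a′ x′ q′) (mono c a x q)
mono-Shift c a x q α β γ refl refl refl = record
  { loA-shift = refl
  ; loX-shift = refl
  ; loQ-shift = refl
  ; coeff-shift = λ A X Q →
      trans (cong₃ (λ b₁ b₂ b₃ → if b₁ ∧ b₂ ∧ b₃ then c else + 0)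
                   (does-≟-shift A a α) (does-≟-shift X x β) (does-≟-shift Q q γ))
            (sym (ℤₚ.*-identityˡ _))
  }

mono-⊗-Shift : ∀ c α β γ {f} → Valid f → Shift c α β γ (mono c α β γ ⊗ f) f
mono-⊗-Shift c α β γ {f} valid = record
  { loA-shift = ℤₚ.+-comm α (loA f)
  ; loX-shift = ℤₚ.+-comm β (loX f)
  ; loQ-shift = ℤₚ.+-comm γ (loQ f)
  ; coeff-shift = coeff-mono-⊗ c α β γ f valid
  }

Shift-mono-⊗⁻¹ : ∀ α β γ {f} → Valid f → Shift (+ 1) (- α) (- β) (- γ) f (mono (+ 1) α β γ ⊗ f)
Shift-mono-⊗⁻¹ α β γ {f} valid = record
  { loA-shift = sym (cancel α (loA f))
  ; loX-shift = sym (cancel β (loX f))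
  ; loQ-shift = sym (cancel γ (loQ f))
  ; coeff-shift = λ A X Q → sym (begin
      + 1 * coeff (mono (+ 1) α β γ ⊗ f) (A - - α) (X - - β) (Q - - γ)
    ≡⟨ ℤₚ.*-identityˡ _ ⟩
      coeff (mono (+ 1) α β γ ⊗ f) (A - - α) (X - - β) (Q - - γ)
    ≡⟨ coeff-mono-⊗ (+ 1) α β γ f valid (A - - α) (X - - β) (Q - - γ) ⟩
      + 1 * coeff f (A - - α - α) (X - - β - β) (Q - - γ - γ)
    ≡⟨ ℤₚ.*-identityˡ _ ⟩
      coeff f (A - - α - α) (X - - β - β) (Q - - γ - γ)
    ≡⟨ cong₃ (coeff f) (uncancel A α) (uncancel X β) (uncancel Q γ) ⟩
      coeff f A X Q ∎)
  }
  where
  cancel : ∀ e l → (e + l) + - e ≡ l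
  cancel = solve-∀
  uncancel : ∀ A e → A - - e - e ≡ A
  uncancel = solve-∀

Shift-trans : ∀ {c α β γ c′ α′ β′ γ′ f g h} → Shift c α β γ f g → Shift c′ α′ β′ γ′ g h →
              Shift (c * c′) (α + α′) (β + β′) (γ + γ′) f h
Shift-trans {c} {α} {β} {γ} {c′} {α′} {β′} {γ′} {f} {g} {h} f≈g g≈h = record
  { loA-shift = trans (loA-shift f≈g) (trans (cong (_+ α) (loA-shift g≈h)) (swap (loA h) α′ α))
  ; loX-shift = trans (loX-shift f≈g) (trans (cong (_+ β) (loX-shift g≈h)) (swap (loX h) β′ β))
  ; loQ-shift = trans (loQ-shift f≈g) (trans (cong (_+ γ) (loQ-shift g≈h)) (swap (loQ h) γ′ γ))
  ; coeff-shift = λ A X Q → begin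
      coeff f A X Q
    ≡⟨ coeff-shift f≈g A X Q ⟩
      c * coeff g (A - α) (X - β) (Q - γ)
    ≡⟨ cong (c *_) (coeff-shift g≈h (A - α) (X - β) (Q - γ)) ⟩
      c * (c′ * coeff h (A - α - α′) (X - β - β′) (Q - γ - γ′))
    ≡⟨ cong (λ v → c * (c′ * v)) (cong₃ (coeff h) (minus-+ A α α′) (minus-+ X β β′) (minus-+ Q γ γ′)) ⟩
      c * (c′ * coeff h (A - (α + α′)) (X - (β + β′)) (Q - (γ + γ′)))
    ≡⟨ ℤₚ.*-assoc c c′ _ ⟨
      c * c′ * coeff h (A - (α + α′)) (X - (β + β′)) (Q - (γ + γ′)) ∎
  }
  where
  swap : ∀ l e′ e → (l + e′) + e ≡ l + (e + e′)
  swap = solve-∀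
  minus-+ : ∀ A e e′ → A - e - e′ ≡ A - (e + e′)
  minus-+ = solve-∀

+-distribˡ-⊓ : ∀ a b c → a + (b ⊓ c) ≡ (a + b) ⊓ (a + c)
+-distribˡ-⊓ a = ℤₚ.mono-≤-distrib-⊓ (ℤₚ.+-monoʳ-≤ a)

+-distribʳ-⊓ : ∀ a b c → (b ⊓ c) + a ≡ (b + a) ⊓ (c + a)
+-distribʳ-⊓ a = ℤₚ.mono-≤-distrib-⊓ (ℤₚ.+-monoˡ-≤ a)

+-⊓-minus : ∀ α e → α + (+ 0 ⊓ (e - α)) ≡ α ⊓ e
+-⊓-minus α e = trans (+-distribˡ-⊓ α (+ 0) (e - α)) (cong₂ _⊓_ (ℤₚ.+-identityʳ α) (cancel α e))
  where
  cancel : ∀ α e → α + (e - α) ≡ e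
  cancel = solve-∀

-- With m = a^α x^β q^γ and s = a^eA x^eX q^eQ: if f = m g then f (1 - s/m) = m g - s g = -s g (1 - m/s).
Shift-⊗-one-minus : ∀ {α β γ f g} → Shift (+ 1) α β γ f g → Valid f → Valid g →
  ∀ eA eX eQ {uA uX uQ vA vX vQ} → uA ≡ eA - α → uX ≡ eX - β → uQ ≡ eQ - γ →
  vA ≡ α - eA → vX ≡ β - eX → vQ ≡ γ - eQ →
  Shift (- + 1) eA eX eQ (f ⊗ (oneS ⊖ mono (+ 1) uA uX uQ)) (g ⊗ (oneS ⊖ mono (+ 1) vA vX vQ))
Shift-⊗-one-minus {α} {β} {γ} {f} {g} f≈g valid-f valid-g eA eX eQ refl refl refl refl refl refl = record
  { loA-shift = trans (cong (_+ (+ 0 ⊓ (eA - α))) (loA-shift f≈g)) (lower-bound (loA g) α eA)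
  ; loX-shift = trans (cong (_+ (+ 0 ⊓ (eX - β))) (loX-shift f≈g)) (lower-bound (loX g) β eX)
  ; loQ-shift = trans (cong (_+ (+ 0 ⊓ (eQ - γ))) (loQ-shift f≈g)) (lower-bound (loQ g) γ eQ)
  ; coeff-shift = λ A X Q → begin
      coeff (f ⊗ (oneS ⊖ mono (+ 1) (eA - α) (eX - β) (eQ - γ))) A X Q
    ≡⟨ coeff-⊗-one-minus f valid-f (eA - α) (eX - β) (eQ - γ) A X Q ⟩
      coeff f A X Q - coeff f (A - (eA - α)) (X - (eX - β)) (Q - (eQ - γ))
    ≡⟨ cong₂ _-_ (coeff-shift f≈g A X Q)
                 (coeff-shift f≈g (A - (eA - α)) (X - (eX - β)) (Q - (eQ - γ))) ⟩
      + 1 * coeff g (A - α) (X - β) (Q - γ)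
        - + 1 * coeff g (A - (eA - α) - α) (X - (eX - β) - β) (Q - (eQ - γ) - γ)
    ≡⟨ cong₂ (λ s t → + 1 * s - + 1 * t)
             (cong₃ (coeff g) (via A eA α) (via X eX β) (via Q eQ γ))
             (cong₃ (coeff g) (back A eA α) (back X eX β) (back Q eQ γ)) ⟩
      + 1 * coeff g (A - eA - (α - eA)) (X - eX - (β - eX)) (Q - eQ - (γ - eQ))
        - + 1 * coeff g (A - eA) (X - eX) (Q - eQ)
    ≡⟨ flip (coeff g (A - eA) (X - eX) (Q - eQ)) _ ⟩
      - + 1 * (coeff g (A - eA) (X - eX) (Q - eQ)
               - coeff g (A - eA - (α - eA)) (X - eX - (β - eX)) (Q - eQ - (γ - eQ)))
    ≡⟨ cong (- + 1 *_)
            (coeff-⊗-one-minus g valid-g (α - eA) (β - eX) (γ - eQ) (A - eA) (X - eX) (Q - eQ)) ⟨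
      - + 1 * coeff (g ⊗ (oneS ⊖ mono (+ 1) (α - eA) (β - eX) (γ - eQ))) (A - eA) (X - eX) (Q - eQ) ∎
  }
  where
  lower-bound : ∀ l α e → (l + α) + (+ 0 ⊓ (e - α)) ≡ (l + (+ 0 ⊓ (α - e))) + e
  lower-bound l α e = begin
    (l + α) + (+ 0 ⊓ (e - α))   ≡⟨ ℤₚ.+-assoc l α _ ⟩
    l + (α + (+ 0 ⊓ (e - α)))   ≡⟨ cong (λ m → l + m) (trans (+-⊓-minus α e) (ℤₚ.⊓-comm α e)) ⟩
    l + (e ⊓ α)                 ≡⟨ cong (λ m → l + m) (+-⊓-minus e α) ⟨
    l + (e + (+ 0 ⊓ (α - e)))   ≡⟨ swap l e _ ⟩
    (l + (+ 0 ⊓ (α - e))) + e   ∎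
    where
    swap : ∀ l e m → l + (e + m) ≡ (l + m) + e
    swap = solve-∀
  via : ∀ A e α → A - α ≡ A - e - (α - e)
  via = solve-∀
  back : ∀ A e α → A - (e - α) - α ≡ A - e
  back = solve-∀
  flip : ∀ u v → + 1 * v - + 1 * u ≡ - + 1 * (u - v)
  flip = solve-∀

Shift-⊕-cross : ∀ {c α β γ f f′ g g′} → Shift c α β γ f g′ → Shift c α β γ f′ g →
                Shift c α β γ (f ⊕ f′) (g ⊕ g′)
Shift-⊕-cross {c} {α} {β} {γ} {f} {f′} {g} {g′} f≈g′ f′≈g = record
  { loA-shift = lower-bound (loA g) (loA g′) α (loA-shift f≈g′) (loA-shift f′≈g)
  ; loX-shift = lower-bound (loX g) (loX g′) β (loX-shift f≈g′) (loX-shift f′≈g)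
  ; loQ-shift = lower-bound (loQ g) (loQ g′) γ (loQ-shift f≈g′) (loQ-shift f′≈g)
  ; coeff-shift = λ A X Q → begin
      coeff f A X Q + coeff f′ A X Q
    ≡⟨ cong₂ _+_ (coeff-shift f≈g′ A X Q) (coeff-shift f′≈g A X Q) ⟩
      c * coeff g′ (A - α) (X - β) (Q - γ) + c * coeff g (A - α) (X - β) (Q - γ)
    ≡⟨ ℤₚ.*-distribˡ-+ c _ _ ⟨
      c * (coeff g′ (A - α) (X - β) (Q - γ) + coeff g (A - α) (X - β) (Q - γ))
    ≡⟨ cong (c *_) (ℤₚ.+-comm (coeff g′ (A - α) (X - β) (Q - γ)) _) ⟩
      c * (coeff g (A - α) (X - β) (Q - γ) + coeff g′ (A - α) (X - β) (Q - γ)) ∎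
  }
  where
  lower-bound : ∀ m m′ e {l l′} → l ≡ m′ + e → l′ ≡ m + e → l ⊓ l′ ≡ (m ⊓ m′) + e
  lower-bound m m′ e refl refl = trans (sym (+-distribʳ-⊓ e m′ m)) (cong (_+ e) (ℤₚ.⊓-comm m′ m))

Shift-qSum : ∀ {c α β γ la lx lq la′ lx′ lq′ B B′ t t′} →
             la ≡ la′ + α → lx ≡ lx′ + β → lq ≡ lq′ + γ → (∀ Q → B Q ≡ B′ (Q - γ)) →
             (∀ n → Shift c α β γ (t n) (t′ n)) →
             Shift c α β γ (qSum la lx lq B t) (qSum la′ lx′ lq′ B′ t′)
Shift-qSum {c} {α} {β} {γ} {B = B} {B′} {t} {t′} la≡ lx≡ lq≡ B≡ t≈t′ = record
  { loA-shift = la≡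
  ; loX-shift = lx≡
  ; loQ-shift = lq≡
  ; coeff-shift = λ A X Q → begin
      sumℕ (suc (B Q)) (λ n → coeff (t n) A X Q)
    ≡⟨ cong (λ N → sumℕ (suc N) (λ n → coeff (t n) A X Q)) (B≡ Q) ⟩
      sumℕ (suc (B′ (Q - γ))) (λ n → coeff (t n) A X Q)
    ≡⟨ sumℕ-cong (suc (B′ (Q - γ))) (λ n → coeff-shift (t≈t′ n) A X Q) ⟩
      sumℕ (suc (B′ (Q - γ))) (λ n → c * coeff (t′ n) (A - α) (X - β) (Q - γ))
    ≡⟨ sumℕ-*ˡ (suc (B′ (Q - γ))) c (λ n → coeff (t′ n) (A - α) (X - β) (Q - γ)) ⟩
      c * sumℕ (suc (B′ (Q - γ))) (λ n → coeff (t′ n) (A - α) (X - β) (Q - γ)) ∎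
  }

valid-qSum : ∀ {la lx lq B t} → (∀ n → Valid (t n)) →
             (∀ n → la ℤ.≤ loA (t n)) → (∀ n → lx ℤ.≤ loX (t n)) → (∀ n → lq ℤ.≤ loQ (t n)) →
             Valid (qSum la lx lq B t)
valid-qSum {B = B} valid la≤ lx≤ lq≤ A X Q below =
  sumℕ-zero (suc (B Q)) λ n _ → valid n A X Q
    (Sum.map (λ A<la → ℤₚ.<-≤-trans A<la (la≤ n))
             (Sum.map (λ X<lx → ℤₚ.<-≤-trans X<lx (lx≤ n)) (λ Q<lq → ℤₚ.<-≤-trans Q<lq (lq≤ n))) below)

lo-prodN : (lo : Ser → ℤ) → lo oneS ≡ + 0 → (∀ f g → lo (f ⊗ g) ≡ lo f + lo g) →
           ∀ N f z → (∀ m → lo (f m) ≡ z) → lo (prodN N f) ≡ + N * z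
lo-prodN lo lo-one lo-⊗ zero    f z lo-f = trans lo-one (sym (ℤₚ.*-zeroˡ z))
lo-prodN lo lo-one lo-⊗ (suc N) f z lo-f = begin
  lo (prodN N f ⊗ f N)       ≡⟨ lo-⊗ (prodN N f) (f N) ⟩
  lo (prodN N f) + lo (f N)  ≡⟨ cong₂ _+_ (lo-prodN lo lo-one lo-⊗ N f z lo-f) (lo-f N) ⟩
  + N * z + z                ≡⟨ step (+ N) z ⟩
  (+ 1 + + N) * z            ∎
  where
  step : ∀ m z → m * z + z ≡ (+ 1 + m) * z
  step = solve-∀

qexp : ℕ → ℕ → ℤ
qexp k n = + (k ℕ.* n ℕ.* n) - + (n C 2) + + n

C2≤square : ∀ n → n C 2 ℕ.≤ n ℕ.* n
C2≤square zero    = ℕ.z≤n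
C2≤square (suc n) =
  subst (ℕ._≤ suc n ℕ.* suc n) pascal (ℕₚ.≤-trans (ℕₚ.+-monoʳ-≤ n (C2≤square n)) grow)
  where
  pascal : n ℕ.+ n C 2 ≡ suc n C 2
  pascal = trans (cong (ℕ._+ n C 2) (sym (nC1≡n n))) (nCk+nC[k+1]≡[n+1]C[k+1] n 1)
  grow : n ℕ.+ n ℕ.* n ℕ.≤ suc n ℕ.* suc n
  grow = ℕₚ.≤-trans (ℕₚ.+-monoʳ-≤ n (ℕₚ.*-monoʳ-≤ n (ℕₚ.n≤1+n n))) (ℕₚ.n≤1+n _)

qexp-≥-square : ∀ {k} → 2 ≤ k → ∀ n → + (n ℕ.* n) ℤ.≤ qexp k n
qexp-≥-square {k} 2≤k n =
  subst (ℤ._≤ qexp k n) (cancel (+ (n C 2)) (+ (n ℕ.* n)))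
        (ℤₚ.≤-trans (ℤₚ.+-monoˡ-≤ (- + (n C 2)) C2+nn≤knn) (ℤₚ.i≤i+j _ (+ n)))
  where
  cancel : ∀ c s → c + s - c ≡ s
  cancel = solve-∀
  double : ∀ n → 2 ℕ.* n ℕ.* n ≡ n ℕ.* n ℕ.+ n ℕ.* n
  double = ℕ-solve-∀
  C2+nn≤knn : + (n C 2) + + (n ℕ.* n) ℤ.≤ + (k ℕ.* n ℕ.* n)
  C2+nn≤knn = subst (ℤ._≤ + (k ℕ.* n ℕ.* n)) (ℤₚ.pos-+ (n C 2) (n ℕ.* n)) (ℤ.+≤+
    (ℕₚ.≤-trans (ℕₚ.+-monoˡ-≤ (n ℕ.* n) (C2≤square n))
                (subst (ℕ._≤ k ℕ.* n ℕ.* n) (double n) (ℕₚ.*-monoˡ-≤ n (ℕₚ.*-monoˡ-≤ n 2≤k)))))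

mul-≤-squares : ∀ J n → J ℕ.* n ℕ.≤ n ℕ.* n ℕ.+ J ℕ.* J
mul-≤-squares J n with n ℕ.≤? J
... | yes n≤J = ℕₚ.≤-trans (ℕₚ.*-monoʳ-≤ J n≤J) (ℕₚ.m≤n+m (J ℕ.* J) (n ℕ.* n))
... | no n≰J  = ℕₚ.≤-trans (ℕₚ.*-monoˡ-≤ n (ℕₚ.<⇒≤ (ℕₚ.≰⇒> n≰J))) (ℕₚ.m≤m+n (n ℕ.* n) (J ℕ.* J))

square-bound : ∀ J n → - + (J ℕ.* J) ℤ.≤ + (n ℕ.* n) - + (J ℕ.* n)
square-bound J n =
  subst₂ ℤ._≤_ (left (+ (J ℕ.* n)) (+ (J ℕ.* J))) (right (+ (n ℕ.* n)) (+ (J ℕ.* J)) (+ (J ℕ.* n)))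
         (ℤₚ.+-monoˡ-≤ (- + (J ℕ.* n) - + (J ℕ.* J)) Jn≤nn+JJ)
  where
  Jn≤nn+JJ : + (J ℕ.* n) ℤ.≤ + (n ℕ.* n) + + (J ℕ.* J)
  Jn≤nn+JJ = subst (+ (J ℕ.* n) ℤ.≤_) (ℤₚ.pos-+ (n ℕ.* n) (J ℕ.* J)) (ℤ.+≤+ (mul-≤-squares J n))
  left : ∀ u v → u + (- u - v) ≡ - v
  left = solve-∀
  right : ∀ s v u → s + v + (- u - v) ≡ s - u
  right = solve-∀

qexp-minus-bound : ∀ {k} → 2 ≤ k → ∀ n J u → u ℤ.≤ + (J ℕ.* n) → - + (J ℕ.* J) ℤ.≤ qexp k n - u
qexp-minus-bound 2≤k n J u u≤Jn =
  ℤₚ.≤-trans (square-bound J n)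
    (ℤₚ.≤-trans (minus-mono-≤ (+ (n ℕ.* n)) u≤Jn) (ℤₚ.+-monoˡ-≤ (- u) (qexp-≥-square 2≤k n)))

≤-abs : ∀ i → i ℤ.≤ + ∣ i ∣
≤-abs (+ n)    = ℤₚ.≤-refl
≤-abs -[1+ n ] = ℤ.-≤+

qexp-bound : ∀ {k} → 2 ≤ k → ∀ n i →
  - + (∣ i ∣ ℕ.* ∣ i ∣) ℤ.≤ (qexp k n - i * + n) + (+ 0 ⊓ (+ (2 ℕ.* n) * i))
qexp-bound {k} 2≤k n i =
  subst (- + (∣ i ∣ ℕ.* ∣ i ∣) ℤ.≤_) (sym (+-distribˡ-⊓ (qexp k n - i * + n) (+ 0) (+ (2 ℕ.* n) * i)))
    (ℤₚ.⊓-glb (subst (- + (∣ i ∣ ℕ.* ∣ i ∣) ℤ.≤_) (sym (ℤₚ.+-identityʳ _))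
                     (qexp-minus-bound 2≤k n ∣ i ∣ (i * + n) (≤-|in| (i * + n) refl)))
              (subst (- + (∣ i ∣ ℕ.* ∣ i ∣) ℤ.≤_) (sym reflect)
                     (qexp-minus-bound 2≤k n ∣ i ∣ (- (i * + n))
                                       (≤-|in| (- (i * + n)) (ℤₚ.∣-i∣≡∣i∣ (i * + n))))))
  where
  ≤-|in| : ∀ u → ∣ u ∣ ≡ ∣ i * + n ∣ → u ℤ.≤ + (∣ i ∣ ℕ.* n)
  ≤-|in| u ∣u∣≡ = subst (u ℤ.≤_) (cong +_ (trans ∣u∣≡ (ℤₚ.abs-* i (+ n)))) (≤-abs u)
  flip-sign : ∀ e i m → e - i * m + (+ 2 * m) * i ≡ e - - (i * m)
  flip-sign = solve-∀
  reflect : qexp k n - i * + n + + (2 ℕ.* n) * i ≡ qexp k n - - (i * + n)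
  reflect = trans (cong (λ m → qexp k n - i * + n + m * i) (ℤₚ.pos-* 2 n)) (flip-sign (qexp k n) i (+ n))

-- Hterm k i n = monomial i ⊗ factor i ⊗ (factors independent of i). Those factors are written out
-- as in Defs rather than abbreviated: comparing an abbreviation of a long product against Hterm makes
-- the type checker unfold its coefficient sums.
module Summand (k n : ℕ) where

  signPower : Ser
  signPower = mono ((- + 1) ℤ.^ n) (+ n) (+ 0) (+ 0)

  qPower : ℤ → Ser
  qPower i = mono (+ 1) (+ 0) (+ 0) (+ (k ℕ.* n ℕ.* n) - + (n C 2) + + n - i * + n)

  xPower : Ser
  xPower = mono (+ 1) (+ 0) (+ ((k ℕ.∸ 1) ℕ.* n)) (+ 0)

  monomial : ℤ → Ser
  monomial i = signPower ⊗ qPower i ⊗ xPower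

  factor : ℤ → Ser
  factor i = oneS ⊖ mono (+ 1) (+ 0) i (+ (2 ℕ.* n) * i)

  valid-monomial : ∀ i → Valid (monomial i)
  valid-monomial i = valid-⊗ (signPower ⊗ qPower i) xPower

  valid-Hterm : ∀ i → Valid (Hterm k i n)
  valid-Hterm i = valid-⊗
    (monomial i ⊗ factor i ⊗ poch (- + 1) (+ 0) (+ 1) (+ 0) n ⊗ poch (- + 1) (- + 1) (+ 0) (+ 0) n
       ⊗ pochInf (- + 1) (+ 1) (+ 1) (+ (suc n)) ⊗ invPochQ2 n)
    (invPochXInf n)

  loA-Hterm : ∀ i → loA (Hterm k i n) ≡ + 0
  loA-Hterm i = trans (cong₃ (λ p₅ p₆ p₈ → loA (monomial i ⊗ factor i) + p₅ + p₆ + + 0 + p₈ + + 0)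
                             (lo-prodN loA refl (λ _ _ → refl) n _ (+ 0) (λ _ → refl))
                             (lo-prodN loA refl (λ _ _ → refl) n _ (- + 1) (λ _ → refl))
                             (lo-prodN loA refl (λ _ _ → refl) n _ (+ 0) (λ _ → refl)))
                      (simplify (+ n))
    where
    simplify : ∀ m → m + + 0 + + 0 + + 0 + m * + 0 + m * - + 1 + + 0 + m * + 0 + + 0 ≡ + 0
    simplify = solve-∀

  loX-Hterm : ∀ i → loX (Hterm k i n) ≡ + ((k ℕ.∸ 1) ℕ.* n) + (+ 0 ⊓ i)
  loX-Hterm i = trans (cong₃ (λ p₅ p₆ p₈ → loX (monomial i ⊗ factor i) + p₅ + p₆ + + 0 + p₈ + + 0)
                             (lo-prodN loX refl (λ _ _ → refl) n _ (+ 0) (λ _ → refl))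
                             (lo-prodN loX refl (λ _ _ → refl) n _ (+ 0) (λ _ → refl))
                             (lo-prodN loX refl (λ _ _ → refl) n _ (+ 0) (λ _ → refl)))
                      (simplify (+ ((k ℕ.∸ 1) ℕ.* n)) (+ 0 ⊓ i) (+ n))
    where
    simplify : ∀ e l m → e + l + m * + 0 + m * + 0 + + 0 + m * + 0 + + 0 ≡ e + l
    simplify = solve-∀

  loQ-Hterm : ∀ i → loQ (Hterm k i n) ≡ (qexp k n - i * + n) + (+ 0 ⊓ (+ (2 ℕ.* n) * i))
  loQ-Hterm i = trans (cong₃ (λ p₅ p₆ p₈ → loQ (monomial i ⊗ factor i) + p₅ + p₆ + + 0 + p₈ + + 0)
                             (lo-prodN loQ refl (λ _ _ → refl) n _ (+ 0) (λ _ → refl))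
                             (lo-prodN loQ refl (λ _ _ → refl) n _ (+ 0) (λ _ → refl))
                             (lo-prodN loQ refl (λ _ _ → refl) n _ (+ 0) (λ _ → refl)))
                      (simplify (qexp k n - i * + n) (+ 0 ⊓ (+ (2 ℕ.* n) * i)) (+ n))
    where
    simplify : ∀ e l m → + 0 + e + + 0 + l + m * + 0 + m * + 0 + + 0 + m * + 0 + + 0 ≡ e + l
    simplify = solve-∀

  monomial-Shift : ∀ j → Shift (+ 1) (+ 0) (+ 0) (+ (2 ℕ.* n) * j) (monomial (- j)) (monomial j)
  monomial-Shift j = Shift-⊗ʳ
    (Shift-mono-⊗ (mono-Shift (+ 1) (+ 0) (+ 0) (qexp k n - j * + n) (+ 0) (+ 0) (+ (2 ℕ.* n) * j)
                              refl refl exponent)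
                  (valid-mono _ _ _ _) (valid-mono _ _ _ _) ((- + 1) ℤ.^ n) (+ n) (+ 0) (+ 0))
    xPower
    where
    reflect : ∀ e j m → e - - j * m ≡ e - j * m + (+ 2 * m) * j
    reflect = solve-∀
    exponent : qexp k n - - j * + n ≡ qexp k n - j * + n + + (2 ℕ.* n) * j
    exponent = trans (reflect (qexp k n) j (+ n))
                     (cong (λ m → qexp k n - j * + n + m * j) (sym (ℤₚ.pos-* 2 n)))

  Hterm-Shift : ∀ j → Shift (- + 1) (+ 0) (- j) (+ 0) (Hterm k (- j) n) (Hterm k j n)
  Hterm-Shift j =
    Shift-⊗ʳ (Shift-⊗ʳ (Shift-⊗ʳ (Shift-⊗ʳ (Shift-⊗ʳ leading
      (poch (- + 1) (+ 0) (+ 1) (+ 0) n)) (poch (- + 1) (- + 1) (+ 0) (+ 0) n))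
      (pochInf (- + 1) (+ 1) (+ 1) (+ (suc n)))) (invPochQ2 n)) (invPochXInf n)
    where
    neg-* : ∀ m j → m * - j ≡ + 0 - m * j
    neg-* = solve-∀
    double-neg : ∀ j → j ≡ + 0 - - j
    double-neg = solve-∀
    leading : Shift (- + 1) (+ 0) (- j) (+ 0) (monomial (- j) ⊗ factor (- j)) (monomial j ⊗ factor j)
    leading = Shift-⊗-one-minus (monomial-Shift j) (valid-monomial (- j)) (valid-monomial j)
      (+ 0) (- j) (+ 0)
      refl (sym (ℤₚ.+-identityʳ (- j))) (neg-* (+ (2 ℕ.* n)) j)
      refl (double-neg j) (sym (ℤₚ.+-identityʳ _))

⊓-neg : ∀ j → + 0 ⊓ - j ≡ (+ 0 ⊓ j) + - j
⊓-neg (+ zero)  = refl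
⊓-neg (+ suc n) = refl
⊓-neg -[1+ n ]  = sym (ℤₚ.+-inverseʳ -[1+ n ])

Ht-Shift : ∀ k j → Shift (- + 1) (+ 0) (- j) (+ 0) (Ht k (- j)) (Ht k j)
Ht-Shift k j =
  Shift-qSum {B = λ Q → ∣ Q ∣ ℕ.+ ∣ - j ∣} {λ Q → ∣ Q ∣ ℕ.+ ∣ j ∣} {Hterm k (- j)} {Hterm k j}
             refl (⊓-neg j) lower-bound bound (λ n → Summand.Hterm-Shift k n j)
  where
  lower-bound : - + (∣ - j ∣ ℕ.* ∣ - j ∣) ≡ - + (∣ j ∣ ℕ.* ∣ j ∣) + + 0
  lower-bound = trans (cong (λ m → - + (m ℕ.* m)) (ℤₚ.∣-i∣≡∣i∣ j)) (sym (ℤₚ.+-identityʳ _))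
  bound : ∀ Q → ∣ Q ∣ ℕ.+ ∣ - j ∣ ≡ ∣ Q - + 0 ∣ ℕ.+ ∣ j ∣
  bound Q = cong₂ ℕ._+_ (cong ∣_∣ (sym (ℤₚ.+-identityʳ Q))) (ℤₚ.∣-i∣≡∣i∣ j)

valid-Ht : ∀ k → 2 ≤ k → ∀ i → Valid (Ht k i)
valid-Ht k 2≤k i = valid-qSum {B = λ Q → ∣ Q ∣ ℕ.+ ∣ i ∣} {Hterm k i} (λ n → valid-Hterm n i)
  (λ n → ℤₚ.≤-reflexive (sym (loA-Hterm n i)))
  (λ n → subst (+ 0 ⊓ i ℤ.≤_) (sym (loX-Hterm n i)) (ℤₚ.i≤j+i _ _))
  (λ n → subst (- + (∣ i ∣ ℕ.* ∣ i ∣) ℤ.≤_) (sym (loQ-Hterm n i)) (qexp-bound 2≤k n i))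
  where
  open Summand k

-- H̃_{-i+1} = -x^{-(i-1)} H̃_{i-1} = -x^{-i} (x H̃_{i-1}) and x H̃_{-i-1} = -x^{-i} H̃_{i+1}.
numerator-Shift : ∀ k → 2 ≤ k → ∀ i → Shift (- + 1) (+ 0) (- i) (+ 0)
  (Ht k (- i + + 1) ⊕ xpow (+ 1) ⊗ Ht k (- i - + 1)) (Ht k (i + + 1) ⊕ xpow (+ 1) ⊗ Ht k (i - + 1))
numerator-Shift k 2≤k i = Shift-⊕-cross from-Ht[i-1] from-Ht[i+1]
  where
  exponent₁ : ∀ i → - (i - + 1) + - + 1 ≡ - i
  exponent₁ = solve-∀
  index₁ : ∀ i → - (i - + 1) ≡ - i + + 1
  index₁ = solve-∀
  exponent₂ : ∀ i → + 1 + - (i + + 1) ≡ - i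
  exponent₂ = solve-∀
  index₂ : ∀ i → - (i + + 1) ≡ - i - + 1
  index₂ = solve-∀

  x-Shift : ∀ {f} → Valid f → Shift (+ 1) (+ 0) (+ 1) (+ 0) (xpow (+ 1) ⊗ f) f
  x-Shift = mono-⊗-Shift (+ 1) (+ 0) (+ 1) (+ 0)
  x-Shift⁻¹ : ∀ {f} → Valid f → Shift (+ 1) (+ 0) (- + 1) (+ 0) f (xpow (+ 1) ⊗ f)
  x-Shift⁻¹ = Shift-mono-⊗⁻¹ (+ 0) (+ 1) (+ 0)

  from-Ht[i-1] : Shift (- + 1) (+ 0) (- i) (+ 0) (Ht k (- i + + 1)) (xpow (+ 1) ⊗ Ht k (i - + 1))
  from-Ht[i-1] =
    subst₂ (λ j e → Shift (- + 1) (+ 0) e (+ 0) (Ht k j) (xpow (+ 1) ⊗ Ht k (i - + 1)))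
           { - (i - + 1)} { - i + + 1} { - (i - + 1) + - + 1} { - i} (index₁ i) (exponent₁ i)
           (Shift-trans (Ht-Shift k (i - + 1)) (x-Shift⁻¹ {Ht k (i - + 1)} (valid-Ht k 2≤k (i - + 1))))

  from-Ht[i+1] : Shift (- + 1) (+ 0) (- i) (+ 0) (xpow (+ 1) ⊗ Ht k (- i - + 1)) (Ht k (i + + 1))
  from-Ht[i+1] =
    subst₂ (λ j e → Shift (- + 1) (+ 0) e (+ 0) (xpow (+ 1) ⊗ Ht k j) (Ht k (i + + 1)))
           { - (i + + 1)} { - i - + 1} {+ 1 + - (i + + 1)} { - i} (index₂ i) (exponent₂ i)
           (Shift-trans (x-Shift {Ht k (- (i + + 1))} (valid-Ht k 2≤k (- (i + + 1))))
                        (Ht-Shift k (i + + 1)))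

Htt-Shift : ∀ k → 2 ≤ k → ∀ i → Shift (- + 1) (+ 0) (- i) (+ 0) (Htt k (- i)) (Htt k i)
Htt-Shift k 2≤k i = Shift-⊗ʳ (numerator-Shift k 2≤k i) (geom (- + 1) 0 1 0)

valid-Htt : ∀ k i → Valid (Htt k i)
valid-Htt k i = valid-⊗ (Ht k (i + + 1) ⊕ xpow (+ 1) ⊗ Ht k (i - + 1)) (geom (- + 1) 0 1 0)

i≡-i⇒i≡0 : ∀ {i} → i ≡ - i → i ≡ + 0
i≡-i⇒i≡0 {+ zero}    _  = refl
i≡-i⇒i≡0 {+ suc n}   ()
i≡-i⇒i≡0 { -[1+ n ]} ()

Shift⇒≈S-negS : ∀ e f g → Shift (- + 1) (+ 0) e (+ 0) f g → Valid g → f ≈S negS (xpow e ⊗ g)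
Shift⇒≈S-negS e f g f≈g valid A X Q = begin
    coeff f A X Q
  ≡⟨ coeff-shift f≈g A X Q ⟩
    - + 1 * coeff g (A - + 0) (X - e) (Q - + 0)
  ≡⟨ ℤₚ.-1*i≡-i _ ⟩
    - coeff g (A - + 0) (X - e) (Q - + 0)
  ≡⟨ cong -_ (trans (coeff-mono-⊗ (+ 1) (+ 0) e (+ 0) g valid A X Q) (ℤₚ.*-identityˡ _)) ⟨
    - coeff (xpow e ⊗ g) A X Q ∎

Shift-neg-self⇒≈0 : ∀ f → Shift (- + 1) (+ 0) (+ 0) (+ 0) f f → f ≈S zeroS
Shift-neg-self⇒≈0 f f≈-f A X Q = i≡-i⇒i≡0 (begin
    coeff f A X Q
  ≡⟨ coeff-shift f≈-f A X Q ⟩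
    - + 1 * coeff f (A - + 0) (X - + 0) (Q - + 0)
  ≡⟨ cong (- + 1 *_) (cong₃ (coeff f) (ℤₚ.+-identityʳ A) (ℤₚ.+-identityʳ X) (ℤₚ.+-identityʳ Q)) ⟩
    - + 1 * coeff f A X Q
  ≡⟨ ℤₚ.-1*i≡-i _ ⟩
    - coeff f A X Q ∎)

mainTheorem11 : (k : ℕ) → 2 ≤ k →
    (Htt k (+ 0) ≈S zeroS) ×
    ((i : ℤ) → Htt k (- i) ≈S negS (xpow (- i) ⊗ Htt k i))
mainTheorem11 k 2≤k =
  Shift-neg-self⇒≈0 (Htt k (+ 0)) Htt-Shift₀ ,
  λ i → Shift⇒≈S-negS (- i) (Htt k (- i)) (Htt k i) (Htt-Shift k 2≤k i) (valid-Htt k i)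
  where
  -- Htt-Shift k 2≤k (+ 0) already has this type since - + 0 reduces to + 0, but letting the
  -- checker discover that unfolds both series; transporting along refl keeps the check syntactic.
  Htt-Shift₀ : Shift (- + 1) (+ 0) (+ 0) (+ 0) (Htt k (+ 0)) (Htt k (+ 0))
  Htt-Shift₀ = subst (λ j → Shift (- + 1) (+ 0) j (+ 0) (Htt k j) (Htt k (+ 0))) {x = - + 0} {y = + 0}
                     refl (Htt-Shift k 2≤k (+ 0))
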